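{- Let $\mathbb{F}$ be any field, let $m\le n$, and let $G=([m]\cup[n],E)$ be a bipartite graph with $E\subseteq[m]\times[n]$. Let $\mathcal{S}_G=\langle \mathrm{E}_{i,j}\mid (i,j)\in E\rangle\le \mathrm{M}(m\times n,\mathbb{F})$. Then for each $r\in[m]$, the maximum number of edges of a spanning subgraph of $G$ whose matching number is at most $r$ equals the largest dimension of a linear subspace of $\mathcal{S}_G$ in which every matrix has rank at most $r$.
   Context: $\mathrm{E}_{i,j}$ denotes the $m\times n$ matrix with $1$ in position $(i,j)$ and $0$ elsewhere. A spanning subgraph of $G$ has the same vertex set and an edge set contained in $E$. A matching is a set of edges no two of which share a vertex; the matching number is the maximum size of a matching. -}

module Defs where

open import Level using (Level; _⊔_; suc)
open import Algebra.Bundles using (CommutativeRing)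
open import Data.Nat as ℕ using (ℕ; _≤_)
open import Data.Fin using (Fin)
open import Data.Bool using (Bool; true; false; if_then_else_)
open import Data.Product using (Σ; _×_; ∃; ∃-syntax)
open import Function using (_⇔_)
open import Function.Definitions using (Injective)
open import Relation.Nullary using (¬_)
open import Relation.Binary.PropositionalEquality using (_≡_)
import Data.Vec.Functional as VF

record Field (c ℓ : Level) : Set (Level.suc (c ⊔ ℓ)) where
  field
    commutativeRing : CommutativeRing c ℓ
  open CommutativeRing commutativeRing public
  field
    0≉1     : ¬ (0# ≈ 1#)
    inverse : ∀ x → ¬ (x ≈ 0#) → ∃[ y ] (x * y ≈ 1#)

sumℕ : ∀ {k} → (Fin k → ℕ) → ℕ
sumℕ {k} f = VF.foldr ℕ._+_ 0 f

BGraph : ℕ → ℕ → Set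
BGraph m n = Fin m → Fin n → Bool

_⊆G_ : ∀ {m n} → BGraph m n → BGraph m n → Set
H ⊆G G = ∀ i j → H i j ≡ true → G i j ≡ true

numEdges : ∀ {m n} → BGraph m n → ℕ
numEdges H = sumℕ (λ i → sumℕ (λ j → if H i j then 1 else 0))

HasMatching : ∀ {m n} → BGraph m n → ℕ → Set
HasMatching {m} {n} H s =
  Σ (Fin s → Fin m) λ f → Σ (Fin s → Fin n) λ g →
    Injective _≡_ _≡_ f × Injective _≡_ _≡_ g × (∀ t → H (f t) (g t) ≡ true)

MatchingNumber≤ : ∀ {m n} → BGraph m n → ℕ → Set
MatchingNumber≤ H r = ¬ HasMatching H (ℕ.suc r)

IsMax : ∀ {p} → (ℕ → Set p) → ℕ → Set p
IsMax P k = P k × (∀ j → P j → j ≤ k)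

module LinAlg {c ℓ} (𝔽 : Field c ℓ) where
  open Field 𝔽

  Vec𝔽 : ℕ → Set c
  Vec𝔽 n = Fin n → Carrier

  Mat : ℕ → ℕ → Set c
  Mat m n = Fin m → Fin n → Carrier

  Σ𝔽 : ∀ {k} → (Fin k → Carrier) → Carrier
  Σ𝔽 f = VF.foldr _+_ 0# f

  linCombV : ∀ {k n} → (Fin k → Carrier) → (Fin k → Vec𝔽 n) → Vec𝔽 n
  linCombV cs vs x = Σ𝔽 (λ t → cs t * vs t x)

  LinIndepV : ∀ {k n} → (Fin k → Vec𝔽 n) → Set (c ⊔ ℓ)
  LinIndepV {k} vs = ∀ (cs : Fin k → Carrier) →
    (∀ x → linCombV cs vs x ≈ 0#) → ∀ t → cs t ≈ 0#

  Rank≤ : ∀ {m n} → Mat m n → ℕ → Set (c ⊔ ℓ)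
  Rank≤ {m} A r = ¬ (Σ (Fin (ℕ.suc r) → Fin m) λ sel → LinIndepV (λ t → A (sel t)))

  linCombM : ∀ {k m n} → (Fin k → Carrier) → (Fin k → Mat m n) → Mat m n
  linCombM cs Ms i j = Σ𝔽 (λ t → cs t * Ms t i j)

  LinIndepM : ∀ {k m n} → (Fin k → Mat m n) → Set (c ⊔ ℓ)
  LinIndepM {k} Ms = ∀ (cs : Fin k → Carrier) →
    (∀ i j → linCombM cs Ms i j ≈ 0#) → ∀ t → cs t ≈ 0#

  -- A ∈ S_G = span{ E_ij | (i,j) ∈ E }: entries outside E vanish
  InS : ∀ {m n} → BGraph m n → Mat m n → Set ℓ
  InS G A = ∀ i j → G i j ≡ false → A i j ≈ 0#

  -- there is a k-dimensional subspace of S_G all of whose elements have rank ≤ r: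
  -- it is the span of k linearly independent matrices in S_G, and every element
  -- of the span has rank ≤ r.
  HasRankBoundedSubspace : ∀ {m n} → BGraph m n → ℕ → ℕ → Set (c ⊔ ℓ)
  HasRankBoundedSubspace {m} {n} G r k =
    Σ (Fin k → Mat m n) λ Ms →
      LinIndepM Ms × (∀ t → InS G (Ms t)) ×
      (∀ (cs : Fin k → Carrier) → Rank≤ (linCombM cs Ms) r)

HasSparseSubgraph : ∀ {m n} → BGraph m n → ℕ → ℕ → Set
HasSparseSubgraph G r k = Σ _ λ H → H ⊆G G × MatchingNumber≤ H r × numEdges H ≡ k

{-# OPTIONS --safe #-}
module Submission where

-- Given a subspace V of 𝒮_G, let H be the set of lexicographically leading
-- positions of the elements of V; then H ⊆ G and |H| = dim V.  If H had a
-- matching (i₁,j₁), …, (iₛ,jₛ) with s > r, led by A₁, …, Aₛ ∈ V, then the rows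
-- iₜ of Aₜ would be independent, having distinct leading columns.  Going down
-- the rows, one replaces row iₜ of Aₜ by row iₜ of a combination of A₁, …, Aₜ:
-- of w and w + v at least one lies outside a hyperplane not containing v, so
-- the family stays independent, and a matrix of rank ≥ s in V results.
-- Conversely, a matrix supported on H with s independent rows yields a matching
-- of size s in H, by exchanging these rows for standard basis vectors.

open import Defs
open import Level using (Level)
open import Data.Nat as ℕ using (ℕ; zero; suc; _≤_; z≤n; s≤s)
open import Data.Nat.Induction using (<-wellFounded; Acc; acc)
import Data.Nat.Properties as ℕₚ
import Algebra.Properties.CommutativeMonoid.Sum
open import Data.Fin using (Fin; zero; suc; toℕ; punchIn; combine; remQuot; _↑ˡ_; _↑ʳ_; finToFun; funToFin)
open import Data.Fin.Properties as Finₚ using (_≟_; any?; all?)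
open import Data.Bool using (Bool; true; false; if_then_else_)
import Data.Bool.Properties as Boolₚ
open import Data.Unit using (⊤; tt)
open import Data.Product using (_×_; ∃; ∃-syntax; _,_; proj₁; proj₂; uncurry)
open import Data.Vec.Functional using (insertAt; updateAt; _∷_)
import Data.Vec.Functional.Properties as VFₚ
open import Function using (_⇔_; _∘_; const; mk⇔; Inverse)
open import Function.Definitions using (Injective)
open import Relation.Binary.Definitions using (tri<; tri≈; tri>)
open import Relation.Binary.PropositionalEquality as ≡ using (_≡_; _≢_; _≗_)
open import Relation.Nullary using (¬_; Dec; yes; no; does; contradiction)
open import Relation.Nullary.Decidable
  using (dec-true; dec-false; map′; ¬?; _×-dec_; _→-dec_; decidable-stable; ¬¬-excluded-middle)

private variable
  a b p : Level
  A : Set a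
  B : Set b

-- Counting and listing the edges of a bipartite graph

count : ∀ {N} → (Fin N → Bool) → ℕ
count h = sumℕ (λ q → if h q then 1 else 0)

module ℕ-Sum = Algebra.Properties.CommutativeMonoid.Sum ℕₚ.+-0-commutativeMonoid

sumℕ-++ : ∀ m {n} (f : Fin (m ℕ.+ n) → ℕ) →
  sumℕ f ≡ sumℕ (λ i → f (i ↑ˡ n)) ℕ.+ sumℕ (λ j → f (m ↑ʳ j))
sumℕ-++ zero    f = ≡.refl
sumℕ-++ (suc m) f = ≡.trans (≡.cong (f zero ℕ.+_) (sumℕ-++ m (f ∘ suc))) (≡.sym (ℕₚ.+-assoc (f zero) _ _))

sumℕ-combine : ∀ m {n} (f : Fin (m ℕ.* n) → ℕ) →
  sumℕ f ≡ sumℕ {m} (λ i → sumℕ {n} (λ j → f (combine i j)))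
sumℕ-combine zero        f = ≡.refl
sumℕ-combine (suc m) {n} f = ≡.trans (sumℕ-++ n f) (≡.cong (sumℕ (λ j → f (j ↑ˡ (m ℕ.* n))) ℕ.+_)
  (sumℕ-combine m (λ q → f (n ↑ʳ q))))

numEdges-cong : ∀ {m n} {H K : BGraph m n} → (∀ i j → H i j ≡ K i j) → numEdges H ≡ numEdges K
numEdges-cong H≗K = ℕ-Sum.sum-cong-≗ (λ i → ℕ-Sum.sum-cong-≗ (λ j → ≡.cong (if_then 1 else 0) (H≗K i j)))

flatten : ∀ {m n} {A : Set a} → (Fin m → Fin n → A) → Fin (m ℕ.* n) → A
flatten {n = n} M q = uncurry M (remQuot n q)

flatten-combine : ∀ {m n} {A : Set a} (M : Fin m → Fin n → A) i j → flatten M (combine i j) ≡ M i j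
flatten-combine M i j = ≡.cong (uncurry M) (Finₚ.remQuot-combine i j)

count-flatten : ∀ {m n} (H : BGraph m n) → count (flatten H) ≡ numEdges H
count-flatten {m} H = ≡.trans (sumℕ-combine m _) (numEdges-cong (flatten-combine H))

-- Indexes the matrix units of a graph by exactly as many labels as it has edges.
enumerate : ∀ {N} (h : Fin N → Bool) →
  ∃[ e ] (Injective _≡_ _≡_ e × (∀ (t : Fin (count h)) → h (e t) ≡ true))
enumerate {zero} h = (λ ()) , (λ { {()} }) , (λ ())
enumerate {suc N} h with h zero in h₀ | enumerate (h ∘ suc)
... | false | e , e-inj , true-at = suc ∘ e , e-inj ∘ Finₚ.suc-injective , true-at
... | true  | e , e-inj , true-at = zero ∷ (suc ∘ e) , inj , λ { zero → h₀ ; (suc t) → true-at t }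
  where
  inj : Injective _≡_ _≡_ (zero ∷ (suc ∘ e))
  inj {zero}  {zero}  _  = ≡.refl
  inj {suc t} {suc u} eq = ≡.cong suc (e-inj (Finₚ.suc-injective eq))

-- Deciding whether a sparse subgraph exists

-- The functions are coded by a finite set and searched. A decoded function agrees with the original
-- only pointwise, whence the closure of `P` under `≗`.
Fin→-any? : ∀ {k n} {P : (Fin k → Fin n) → Set p} → (∀ {f g} → f ≗ g → P f → P g) →
  (∀ f → Dec (P f)) → Dec (∃ P)
Fin→-any? resp P? = map′ (λ (c , pc) → finToFun c , pc)
  (λ (f , pf) → funToFin f , resp (≡.sym ∘ Finₚ.finToFun-funToFin f) pf) (any? (P? ∘ finToFun))

Injective-resp-≗ : ∀ {k n} {f g : Fin k → Fin n} → f ≗ g → Injective _≡_ _≡_ f → Injective _≡_ _≡_ g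
Injective-resp-≗ f≗g f-inj {t} {u} gt≡gu = f-inj (≡.trans (f≗g t) (≡.trans gt≡gu (≡.sym (f≗g u))))

injective? : ∀ {k n} (f : Fin k → Fin n) → Dec (Injective _≡_ _≡_ f)
injective? f = map′ (λ inj {t} {u} → inj t u) (λ inj t u → inj)
  (all? (λ t → all? (λ u → (f t ≟ f u) →-dec (t ≟ u))))

HasMatching? : ∀ {m n} (H : BGraph m n) s → Dec (HasMatching H s)
HasMatching? H s = Fin→-any?
  (λ f≗f′ (g , f-inj , g-inj , edge) → g , Injective-resp-≗ f≗f′ f-inj , g-inj ,
    (λ t → ≡.trans (≡.cong (λ i → H i (g t)) (≡.sym (f≗f′ t))) (edge t)))
  (λ f → Fin→-any?
    (λ g≗g′ (f-inj , g-inj , edge) → f-inj , Injective-resp-≗ g≗g′ g-inj ,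
      (λ t → ≡.trans (≡.cong (H (f t)) (≡.sym (g≗g′ t))) (edge t)))
    (λ g → injective? f ×-dec injective? g ×-dec all? (λ t → H (f t) (g t) Boolₚ.≟ true)))

_⊆G?_ : ∀ {m n} (H G : BGraph m n) → Dec (H ⊆G G)
H ⊆G? G = all? (λ i → all? (λ j → (H i j Boolₚ.≟ true) →-dec (G i j Boolₚ.≟ true)))

-- The linear algebra produces a subgraph only under double negation; decidability by finite search
-- removes it.
HasSparseSubgraph? : ∀ {m n} (G : BGraph m n) r k → Dec (HasSparseSubgraph G r k)
HasSparseSubgraph? {m} {n} G r k = map′
  (λ (h , sparse) → decode h , sparse)
  (λ (H , sparse) → from ∘ flatten H , resp (λ i j → ≡.sym (decode-encode H i j)) sparse)
  (Fin→-any? (λ h≗h′ → resp (λ i j → ≡.cong to (h≗h′ (combine i j))))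
    (λ h → (decode h ⊆G? G) ×-dec ¬? (HasMatching? (decode h) (suc r)) ×-dec (numEdges (decode h) ℕ.≟ k)))
  where
  open Inverse Finₚ.2↔Bool using (to; from; strictlyInverseˡ)

  Sparse : BGraph m n → Set
  Sparse H = H ⊆G G × MatchingNumber≤ H r × numEdges H ≡ k

  decode : (Fin (m ℕ.* n) → Fin 2) → BGraph m n
  decode h i j = to (h (combine i j))

  decode-encode : ∀ H i j → decode (from ∘ flatten H) i j ≡ H i j
  decode-encode H i j = ≡.trans (strictlyInverseˡ _) (flatten-combine H i j)

  resp : ∀ {H K} → (∀ i j → H i j ≡ K i j) → Sparse H → Sparse K
  resp H≗K (H⊆G , sparse , size) =
    (λ i j Kij → H⊆G i j (≡.trans (H≗K i j) Kij)) ,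
    (λ (f , g , f-inj , g-inj , edge) → sparse
      (f , g , f-inj , g-inj , λ t → ≡.trans (H≗K (f t) (g t)) (edge t))) ,
    ≡.trans (numEdges-cong (λ i j → ≡.sym (H≗K i j))) size

-- Equality in 𝔽 need not be decidable, so the linear algebra below is carried
-- out under double negation, with case distinctions on finitely many scalars.

infixl 1 _>>=_

_>>=_ : ¬ ¬ A → (A → ¬ ¬ B) → ¬ ¬ B
(x >>= f) k = x (λ y → f y k)

return : A → ¬ ¬ A
return x k = k x

-- Double negation commutes with finite conjunctions, so finitely many classical choices can be made
-- together.
Fin-¬¬-pull : ∀ {k} {P : Fin k → Set p} → (∀ t → ¬ ¬ P t) → ¬ ¬ (∀ t → P t)
Fin-¬¬-pull {k = zero}  h = return (λ ())
Fin-¬¬-pull {k = suc k} h = do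
  p₀ ← h zero
  ps ← Fin-¬¬-pull (h ∘ suc)
  return (λ { zero → p₀ ; (suc t) → ps t })

module _ {c ℓ} (𝔽 : Field c ℓ) where

  open Field 𝔽 hiding (zero)
  open LinAlg 𝔽
  open import Algebra.Properties.Semiring.Sum semiring
    using (sum; sum-cong-≋; sum-replicate-zero; sum-remove; ∑-distrib-+; ∑-comm; *-distribˡ-sum; *-distribʳ-sum)
  open import Algebra.Properties.Ring ring using (-‿distribˡ-*)
  open import Relation.Binary.Reasoning.Setoid setoid

  -- Field arithmetic, finite sums and the dot product

  _≉0 : Carrier → Set ℓ
  x ≉0 = ¬ (x ≈ 0#)

  cancel : ∀ {x y} → y ≉0 → x * y ≈ 0# → x ≈ 0#
  cancel {x} {y} y≉0 xy≈0 with inverse y y≉0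
  ... | i , yi≈1 = begin
    x            ≈⟨ *-identityʳ x ⟨
    x * 1#       ≈⟨ *-congˡ yi≈1 ⟨
    x * (y * i)  ≈⟨ *-assoc x y i ⟨
    x * y * i    ≈⟨ *-congʳ xy≈0 ⟩
    0# * i       ≈⟨ zeroˡ i ⟩
    0#           ∎

  cancel-pivot : ∀ x {y i} → y * i ≈ 1# → x + - (x * i) * y ≈ 0#
  cancel-pivot x {y} {i} yi≈1 = begin
    x + - (x * i) * y    ≈⟨ +-congˡ (-‿distribˡ-* (x * i) y) ⟨
    x + - (x * i * y)    ≈⟨ +-congˡ (-‿cong (trans (*-assoc x i y) (*-congˡ (trans (*-comm i y) yi≈1)))) ⟩
    x + - (x * 1#)       ≈⟨ +-congˡ (-‿cong (*-identityʳ x)) ⟩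
    x + - x              ≈⟨ -‿inverseʳ x ⟩
    0#                   ∎

  sum-zero : ∀ {k} {f : Fin k → Carrier} → (∀ t → f t ≈ 0#) → sum f ≈ 0#
  sum-zero {k} f≈0 = trans (sum-cong-≋ f≈0) (sum-replicate-zero k)

  sum-single : ∀ {k} {f : Fin k → Carrier} t → (∀ u → u ≢ t → f u ≈ 0#) → sum f ≈ f t
  sum-single {suc k} {f} t others = begin
    sum f                         ≈⟨ sum-remove {i = t} f ⟩
    f t + sum (f ∘ punchIn t)     ≈⟨ +-congˡ (sum-zero (λ u → others (punchIn t u) (Finₚ.punchInᵢ≢i t u))) ⟩
    f t + 0#                      ≈⟨ +-identityʳ (f t) ⟩
    f t                           ∎

  δ : ∀ {k} → Fin k → Fin k → Carrier
  δ t u = if does (t ≟ u) then 1# else 0#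

  δ-refl : ∀ {k} (t : Fin k) → δ t t ≈ 1#
  δ-refl t rewrite dec-true (t ≟ t) ≡.refl = refl

  δ-≢ : ∀ {k} {t u : Fin k} → t ≢ u → δ t u ≈ 0#
  δ-≢ {t = t} {u} t≢u rewrite dec-false (t ≟ u) t≢u = refl

  dot : ∀ {n} → Vec𝔽 n → Vec𝔽 n → Carrier
  dot v w = sum (λ x → v x * w x)

  dot-congʳ : ∀ {n} u {v w : Vec𝔽 n} → (∀ x → v x ≈ w x) → dot u v ≈ dot u w
  dot-congʳ u v≈w = sum-cong-≋ (λ x → *-congˡ (v≈w x))

  dot-comm : ∀ {n} (v w : Vec𝔽 n) → dot v w ≈ dot w v
  dot-comm v w = sum-cong-≋ (λ x → *-comm (v x) (w x))

  dot-+ˡ : ∀ {n} (u v w : Vec𝔽 n) → dot (λ x → u x + v x) w ≈ dot u w + dot v w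
  dot-+ˡ u v w = trans (sum-cong-≋ (λ x → distribʳ (w x) (u x) (v x))) (∑-distrib-+ (λ x → u x * w x) (λ x → v x * w x))

  dot-*ˡ : ∀ {n} a (v w : Vec𝔽 n) → dot (λ x → a * v x) w ≈ a * dot v w
  dot-*ˡ a v w = trans (sum-cong-≋ (λ x → *-assoc a (v x) (w x))) (sym (*-distribˡ-sum a (λ x → v x * w x)))

  dot-+*ˡ : ∀ {n} a (u v w : Vec𝔽 n) → dot (λ x → u x + a * v x) w ≈ dot u w + a * dot v w
  dot-+*ˡ a u v w = trans (dot-+ˡ u (λ x → a * v x) w) (+-congˡ (dot-*ˡ a v w))

  dot-linComb : ∀ {k n} (cs : Fin k → Carrier) (vs : Fin k → Vec𝔽 n) w →
    dot (linCombV cs vs) w ≈ dot cs (λ t → dot (vs t) w)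
  dot-linComb cs vs w = begin
    sum (λ x → sum (λ t → cs t * vs t x) * w x)    ≈⟨ sum-cong-≋ (λ x → *-distribʳ-sum (w x) (λ t → cs t * vs t x)) ⟩
    sum (λ x → sum (λ t → cs t * vs t x * w x))    ≈⟨ ∑-comm (λ x t → cs t * vs t x * w x) ⟩
    sum (λ t → sum (λ x → cs t * vs t x * w x))    ≈⟨ sum-cong-≋ (λ t → dot-*ˡ (cs t) (vs t) w) ⟩
    sum (λ t → cs t * dot (vs t) w)                ∎

  dot-δʳ : ∀ {n} (v : Vec𝔽 n) t → dot v (δ t) ≈ v t
  dot-δʳ v t = begin
    dot v (δ t)      ≈⟨ sum-single t (λ u u≢t → trans (*-congˡ (δ-≢ (u≢t ∘ ≡.sym))) (zeroʳ (v u))) ⟩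
    v t * δ t t      ≈⟨ *-congˡ (δ-refl t) ⟩
    v t * 1#         ≈⟨ *-identityʳ (v t) ⟩
    v t              ∎

  dot-δˡ : ∀ {n} t (v : Vec𝔽 n) → dot (δ t) v ≈ v t
  dot-δˡ t v = trans (dot-comm (δ t) v) (dot-δʳ v t)

  ¬¬-nonzero : ∀ {k} (f : Fin k → Carrier) → ¬ (∀ t → f t ≈ 0#) → ¬ ¬ (∃[ t ] f t ≉0)
  ¬¬-nonzero f nz none = Fin-¬¬-pull (λ t ft≉0 → none (t , ft≉0)) nz

  -- Independence through dual families of functionals

  -- A positive witness of independence. It turns the question whether a vector may take the place
  -- of `vs t` into whether the scalar `dot (φ t) w` is nonzero.
  Dual : ∀ {k n} → (Fin k → Vec𝔽 n) → (Fin k → Vec𝔽 n) → Set ℓ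
  Dual φ vs = ∀ t u → dot (φ t) (vs u) ≈ δ t u

  HasDual : ∀ {k n} → (Fin k → Vec𝔽 n) → Set _
  HasDual vs = ∃[ φ ] Dual φ vs

  -- Applying `φ t` to a combination reads off its coefficient at `t`.
  HasDual⇒LinIndep : ∀ {k n} {vs : Fin k → Vec𝔽 n} → HasDual vs → LinIndepV vs
  HasDual⇒LinIndep {vs = vs} (φ , dual) cs comb≈0 t = begin
    cs t                             ≈⟨ dot-δʳ cs t ⟨
    dot cs (δ t)                     ≈⟨ dot-congʳ cs (λ u → trans (dot-comm (vs u) (φ t)) (dual t u)) ⟨
    dot cs (λ u → dot (vs u) (φ t))  ≈⟨ dot-linComb cs vs (φ t) ⟨
    dot (linCombV cs vs) (φ t)       ≈⟨ sum-zero (λ x → trans (*-congʳ (comb≈0 x)) (zeroˡ (φ t x))) ⟩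
    0#                               ∎

  HasDual⇒injective : ∀ {k n} {vs : Fin k → Vec𝔽 n} → HasDual vs → Injective _≡_ _≡_ vs
  HasDual⇒injective {vs = vs} (φ , dual) {t} {u} vt≡vu with t ≟ u
  ... | yes t≡u = t≡u
  ... | no  t≢u = contradiction (begin
    0#                  ≈⟨ δ-≢ t≢u ⟨
    δ t u               ≈⟨ dual t u ⟨
    dot (φ t) (vs u)    ≡⟨ ≡.cong (dot (φ t)) vt≡vu ⟨
    dot (φ t) (vs t)    ≈⟨ dual t t ⟩
    δ t t               ≈⟨ δ-refl t ⟩
    1#                  ∎) 0≉1

  -- Since `ψ` kills every vector except `vs t`, where it is 1, subtracting a multiple of it
  -- corrects the value of `φ u` at `vs t` and leaves the other values alone.
  complete-dual : ∀ {k n} (vs φ : Fin k → Vec𝔽 n) t ψ →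
    (∀ u → dot ψ (vs u) ≈ δ t u) →
    (∀ u u′ → u ≢ t → u′ ≢ t → dot (φ u) (vs u′) ≈ δ u u′) →
    HasDual vs
  complete-dual {k} {n} vs φ t ψ ψ-dual φ-dual = φ′ , dual′
    where
    φ′ : Fin k → Vec𝔽 n
    φ′ u with u ≟ t
    ... | yes _ = ψ
    ... | no  _ = λ x → φ u x + - dot (φ u) (vs t) * ψ x

    dual′ : Dual φ′ vs
    dual′ u u′ with u ≟ t
    ... | yes ≡.refl = ψ-dual u′
    ... | no  u≢t    = trans (dot-+*ˡ _ (φ u) ψ (vs u′)) (corrected u′ (u′ ≟ t))
      where
      d = dot (φ u) (vs t)
      corrected : ∀ u′ → Dec (u′ ≡ t) → dot (φ u) (vs u′) + - d * dot ψ (vs u′) ≈ δ u u′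
      corrected _ (yes ≡.refl) = begin
        d + - d * dot ψ (vs t)   ≈⟨ +-congˡ (*-congˡ (trans (ψ-dual t) (δ-refl t))) ⟩
        d + - d * 1#             ≈⟨ +-congˡ (*-identityʳ (- d)) ⟩
        d + - d                  ≈⟨ -‿inverseʳ d ⟩
        0#                       ≈⟨ δ-≢ u≢t ⟨
        δ u t                    ∎
      corrected u′ (no u′≢t) = begin
        dot (φ u) (vs u′) + - d * dot ψ (vs u′)
          ≈⟨ +-cong (φ-dual u u′ u≢t u′≢t) (*-congˡ (trans (ψ-dual u′) (δ-≢ (u′≢t ∘ ≡.sym)))) ⟩
        δ u u′ + - d * 0#    ≈⟨ +-congˡ (zeroʳ (- d)) ⟩
        δ u u′ + 0#          ≈⟨ +-identityʳ _ ⟩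
        δ u u′               ∎

  -- Steinitz exchange: `φ t` already kills the other vectors, so dividing it by its value on `w`
  -- gives the functional for `w`.
  exchange : ∀ {k n} {vs φ : Fin k → Vec𝔽 n} → Dual φ vs → ∀ t w → dot (φ t) w ≉0 →
    HasDual (updateAt vs t (const w))
  exchange {k} {n} {vs} {φ} dual t w φw≉0 with inverse _ φw≉0
  ... | i , φw*i≈1 = complete-dual vs′ φ t ψ (λ u → ψ-dual u (u ≟ t)) φ-dual
    where
    vs′ = updateAt vs t (const w)
    ψ : Vec𝔽 n
    ψ x = i * φ t x

    ψ-dual : ∀ u → Dec (u ≡ t) → dot ψ (vs′ u) ≈ δ t u
    ψ-dual u (yes ≡.refl) rewrite VFₚ.updateAt-updates t {const w} vs = begin
      dot ψ w            ≈⟨ dot-*ˡ i (φ t) w ⟩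
      i * dot (φ t) w    ≈⟨ trans (*-comm i _) φw*i≈1 ⟩
      1#                 ≈⟨ δ-refl t ⟨
      δ t t              ∎
    ψ-dual u (no u≢t) rewrite VFₚ.updateAt-minimal u t {const w} vs u≢t = begin
      dot ψ (vs u)             ≈⟨ dot-*ˡ i (φ t) (vs u) ⟩
      i * dot (φ t) (vs u)     ≈⟨ *-congˡ (trans (dual t u) (δ-≢ (u≢t ∘ ≡.sym))) ⟩
      i * 0#                   ≈⟨ zeroʳ i ⟩
      0#                       ≈⟨ δ-≢ (u≢t ∘ ≡.sym) ⟨
      δ t u                    ∎

    φ-dual : ∀ u u′ → u ≢ t → u′ ≢ t → dot (φ u) (vs′ u′) ≈ δ u u′
    φ-dual u u′ _ u′≢t rewrite VFₚ.updateAt-minimal u′ t {const w} vs u′≢t = dual u u′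

  -- The residual of the first vector modulo the others has a nonzero coordinate j;
  -- normalising the residual of the j-th coordinate functional gives the new functional.
  LinIndep⇒HasDual : ∀ {k n} {vs : Fin k → Vec𝔽 n} → LinIndepV vs → ¬ ¬ HasDual vs
  LinIndep⇒HasDual {zero} indep = return ((λ ()) , (λ ()))
  LinIndep⇒HasDual {suc k} {n} {vs} indep = do
    φ , dual ← LinIndep⇒HasDual {vs = vs ∘ suc} (λ cs comb≈0 t → indep (0# ∷ cs)
      (λ x → trans (+-cong (zeroˡ (vs zero x)) (comb≈0 x)) (+-identityˡ 0#)) (suc t))
    let
      coeff : Fin (suc k) → Carrier
      coeff = 1# ∷ (λ t → - dot (φ t) (vs zero))
      residual = linCombV coeff vs
    -- The residual has coefficient 1 at `vs zero`, so its vanishing would contradict independence.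
    j , rj≉0 ← ¬¬-nonzero residual (λ r≈0 → 0≉1 (sym (indep coeff r≈0 zero)))
    return (extend φ dual j (inverse (residual j) rj≉0))
    where
    v₀ = vs zero
    extend : ∀ φ → Dual φ (vs ∘ suc) → ∀ j →
      (∃[ i ] linCombV (1# ∷ (λ t → - dot (φ t) v₀)) vs j * i ≈ 1#) → HasDual vs
    -- The entry `δ j` is a default at index `zero`, where `complete-dual` puts `ψ`.
    extend φ dual j (i , ri≈1) = complete-dual vs (δ j ∷ φ) zero ψ ψ-dual φ-dual
      where
      -- By duality of `φ` this kills each `vs (suc u)`, and on `v₀` it gives coordinate `j` of the
      -- residual, whose inverse is `i`.
      functional : Vec𝔽 n
      functional x = δ j x + - 1# * linCombV (λ t → vs (suc t) j) φ x
      ψ : Vec𝔽 n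
      ψ x = i * functional x

      value : ∀ v → dot ψ v ≈ i * (v j + - 1# * dot (λ t → vs (suc t) j) (λ t → dot (φ t) v))
      value v = begin
        dot ψ v               ≈⟨ dot-*ˡ i functional v ⟩
        i * dot functional v  ≈⟨ *-congˡ (dot-+*ˡ (- 1#) (δ j) _ v) ⟩
        i * (dot (δ j) v + - 1# * dot (linCombV (λ t → vs (suc t) j) φ) v)
          ≈⟨ *-congˡ (+-cong (dot-δˡ j v) (*-congˡ (dot-linComb (λ t → vs (suc t) j) φ v))) ⟩
        i * (v j + - 1# * dot (λ t → vs (suc t) j) (λ t → dot (φ t) v)) ∎

      ψ-dual : ∀ u → dot ψ (vs u) ≈ δ zero u
      ψ-dual zero = begin
        dot ψ v₀         ≈⟨ value v₀ ⟩
        i * (v₀ j + - 1# * dot (λ t → vs (suc t) j) (λ t → dot (φ t) v₀))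
          ≈⟨ *-congˡ (+-cong (sym (*-identityˡ (v₀ j)))
              (trans (*-distribˡ-sum (- 1#) (λ t → vs (suc t) j * dot (φ t) v₀)) (sum-cong-≋ (λ t → swap (vs (suc t) j) (dot (φ t) v₀))))) ⟩
        i * linCombV (1# ∷ (λ t → - dot (φ t) v₀)) vs j   ≈⟨ trans (*-comm i _) ri≈1 ⟩
        1#               ∎
        where
        swap : ∀ x y → - 1# * (x * y) ≈ - y * x
        swap x y = begin
          - 1# * (x * y)     ≈⟨ -‿distribˡ-* 1# (x * y) ⟨
          - (1# * (x * y))   ≈⟨ -‿cong (trans (*-identityˡ _) (*-comm x y)) ⟩
          - (y * x)          ≈⟨ -‿distribˡ-* y x ⟩
          - y * x            ∎
      ψ-dual (suc u) = begin
        dot ψ (vs (suc u))         ≈⟨ value (vs (suc u)) ⟩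
        i * (vs (suc u) j + - 1# * dot (λ t → vs (suc t) j) (λ t → dot (φ t) (vs (suc u))))
          ≈⟨ *-congˡ (+-congˡ (*-congˡ (trans (dot-congʳ _ (λ t → trans (dual t u) (δ-sym t u))) (dot-δʳ _ u)))) ⟩
        i * (vs (suc u) j + - 1# * vs (suc u) j)
          ≈⟨ *-congˡ (+-congˡ (trans (sym (-‿distribˡ-* 1# _)) (-‿cong (*-identityˡ _)))) ⟩
        i * (vs (suc u) j + - vs (suc u) j)     ≈⟨ *-congˡ (-‿inverseʳ _) ⟩
        i * 0#                                  ≈⟨ zeroʳ i ⟩
        0#                                      ∎
        where
        δ-sym : ∀ {k} (t u : Fin k) → δ t u ≈ δ u t
        δ-sym t u with t ≟ u
        ... | yes ≡.refl = sym (δ-refl t)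
        ... | no t≢u = sym (δ-≢ (t≢u ∘ ≡.sym))

      φ-dual : ∀ u u′ → u ≢ zero → u′ ≢ zero → dot ((δ j ∷ φ) u) (vs u′) ≈ δ u u′
      φ-dual zero    _        u≢0 _    = contradiction ≡.refl u≢0
      φ-dual (suc u) zero     _   u′≢0 = contradiction ≡.refl u′≢0
      φ-dual (suc u) (suc u′) _   _    = trans (dual u u′) (suc-δ u u′)
        where
        suc-δ : ∀ {k} (t u : Fin k) → δ t u ≈ δ (suc t) (suc u)
        suc-δ t u with t ≟ u
        ... | yes _ = refl
        ... | no _ = refl

  -- Replacing independent vectors one by one

  -- The state σ lets a replacement vector depend on the choices made before it.
  sweep : ∀ {k n N} {S : Set a} (Done : S → Fin k → Vec𝔽 n → Set b)
    (key : Fin k → Fin N) → Injective _≡_ _≡_ key →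
    (vs : Fin k → Vec𝔽 n) → HasDual vs → S →
    (∀ σ t φ → dot φ (vs t) ≈ 1# → ¬ ¬ (∃[ σ′ ] ∃[ w ] (dot φ w ≉0 × Done σ′ t w ×
      (∀ u y → toℕ (key u) ℕ.< toℕ (key t) → Done σ u y → Done σ′ u y)))) →
    ¬ ¬ (∃[ σ ] ∃[ us ] (HasDual us × (∀ t → Done σ t (us t))))
  sweep {k = k} {n} {N} {S} Done key key-inj vs vs-dual σ₀ replace = do
    σ , us , us-dual , done , _ ← stage N ℕₚ.≤-refl
    return (σ , us , us-dual , λ t → done t (Finₚ.toℕ<n (key t)))
    where
    Stage : ℕ → Set _
    Stage c = ∃[ σ ] ∃[ us ] (HasDual us × (∀ t → toℕ (key t) ℕ.< c → Done σ t (us t)) ×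
                (∀ t → c ≤ toℕ (key t) → us t ≡ vs t))

    -- As `key` is injective, at most one index is treated per value `c`; values that are no key are
    -- passed over.
    advance : ∀ c → Dec (∃[ t ] toℕ (key t) ≡ c) → Stage c → ¬ ¬ Stage (suc c)
    advance c (no absent) (σ , us , us-dual , done , todo) = return
      ( σ , us , us-dual
      , (λ t <1+c → done t (ℕₚ.≤∧≢⇒< (ℕₚ.≤-pred <1+c) (λ eq → absent (t , eq))))
      , (λ t c< → todo t (ℕₚ.<⇒≤ c<)))
    advance _ (yes (t , ≡.refl)) (σ , us , (φ , φ-dual) , done , todo) = do
      -- Position `t` still holds the original `vs t`, so the current functional `φ t` is 1 there,
      -- although other vectors may have changed.
      σ′ , w , φw≉0 , done-t , preserved ← replace σ t (φ t)
        (≡.subst (λ v → dot (φ t) v ≈ 1#) (todo t ℕₚ.≤-refl) (trans (φ-dual t t) (δ-refl t)))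
      let
        us′ = updateAt us t (const w)

        done′ : ∀ u → Dec (u ≡ t) → toℕ (key u) ℕ.< suc (toℕ (key t)) → Done σ′ u (us′ u)
        done′ = λ
          { u (yes ≡.refl) _ → ≡.subst (Done σ′ t) (≡.sym (VFₚ.updateAt-updates t us)) done-t
          ; u (no u≢t) ≤key → ≡.subst (Done σ′ u) (≡.sym (VFₚ.updateAt-minimal u t us u≢t))
              (let <key = ℕₚ.≤∧≢⇒< (ℕₚ.≤-pred ≤key) (u≢t ∘ key-inj ∘ Finₚ.toℕ-injective)
               in preserved u (us u) <key (done u <key)) }
      return ( σ′ , us′ , exchange φ-dual t w φw≉0 , (λ u → done′ u (u ≟ t))
             , (λ u key< → ≡.trans
                 (VFₚ.updateAt-minimal u t us (λ { ≡.refl → ℕₚ.<-irrefl ≡.refl key< }))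
                 (todo u (ℕₚ.<⇒≤ key<))))

    stage : ∀ c → c ≤ N → ¬ ¬ Stage c
    stage zero    _   = return (σ₀ , vs , vs-dual , (λ _ ()) , (λ _ _ → ≡.refl))
    stage (suc c) c<N = stage c (ℕₚ.<⇒≤ c<N) >>= advance c (any? (λ t → toℕ (key t) ℕ.≟ c))

  -- Replacing the rows one by one by standard basis vectors plays the role of
  -- picking a nonzero term in the expansion of a determinant.
  transversal : ∀ {k n} (vs : Fin k → Vec𝔽 n) → HasDual vs →
    ¬ ¬ (∃[ g ] (Injective _≡_ _≡_ g × (∀ t → vs t (g t) ≉0)))
  transversal {k} {n} vs vs-dual = do
    _ , us , us-dual , done ← sweep Done (λ t → t) (λ eq → eq) vs vs-dual tt replace
    return ( (λ t → proj₁ (done t))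
           -- Equal columns would put the same basis vector twice into an independent family.
           , (λ {t} {u} gt≡gu → HasDual⇒injective us-dual
                (≡.trans (proj₁ (proj₂ (done t)))
                  (≡.trans (≡.cong δ gt≡gu) (≡.sym (proj₁ (proj₂ (done u)))))))
           , (λ t → proj₂ (proj₂ (done t))))
    where
    Done : ⊤ → Fin k → Vec𝔽 n → Set _
    Done _ t w = ∃[ j ] (w ≡ δ j × vs t j ≉0)

    replace : ∀ σ t φ → dot φ (vs t) ≈ 1# → ¬ ¬ (∃[ σ′ ] ∃[ w ] (dot φ w ≉0 × Done σ′ t w ×
      (∀ u y → toℕ u ℕ.< toℕ t → Done σ u y → Done σ′ u y)))
    replace _ t φ φv≈1 = do
      -- The products sum to 1, so one is nonzero. Its first factor permits the exchange with `δ j`;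
      -- its second is a nonzero entry of the original row.
      j , φⱼvⱼ≉0 ← ¬¬-nonzero (λ j → φ j * vs t j)
                     (λ zeros → 0≉1 (trans (sym (sum-zero zeros)) φv≈1))
      return ( tt , δ j
             , (λ φδ≈0 → φⱼvⱼ≉0 (trans (*-congʳ (trans (sym (dot-δʳ φ j)) φδ≈0)) (zeroˡ _)))
             , (j , ≡.refl , λ vⱼ≈0 → φⱼvⱼ≉0 (trans (*-congˡ vⱼ≈0) (zeroʳ _)))
             , (λ _ _ _ d → d))

  -- Independent rows in a single matrix of the span

  -- Induction on the leading column. At column `g t`, vectors leading earlier have coefficient zero
  -- by induction and vectors leading later have entry zero, so only the term of `t` survives.
  leading⇒LinIndep : ∀ {k n} (vs : Fin k → Vec𝔽 n) (g : Fin k → Fin n) → Injective _≡_ _≡_ g →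
    (∀ t → vs t (g t) ≉0) → (∀ t j → toℕ j ℕ.< toℕ (g t) → vs t j ≈ 0#) → LinIndepV vs
  leading⇒LinIndep vs g g-inj lead≉0 below≈0 cs comb≈0 t = go t (<-wellFounded (toℕ (g t)))
    where
    go : ∀ t → Acc ℕ._<_ (toℕ (g t)) → cs t ≈ 0#
    go t (acc rec) = cancel (lead≉0 t) (trans (sym (sum-single t others)) (comb≈0 (g t)))
      where
      others : ∀ u → u ≢ t → cs u * vs u (g t) ≈ 0#
      others u u≢t with ℕₚ.<-cmp (toℕ (g u)) (toℕ (g t))
      ... | tri< gu<gt _ _ = trans (*-congʳ (go u (rec gu<gt))) (zeroˡ _)
      ... | tri≈ _ gu≡gt _ = contradiction (g-inj (Finₚ.toℕ-injective gu≡gt)) u≢t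
      ... | tri> _ _ gu>gt = trans (*-congˡ (below≈0 u (g t) gu>gt)) (zeroʳ _)

  -- The coefficients 0 and 1 suffice, so the size of 𝔽 does not matter: if φ
  -- vanishes on the current row, it does not vanish after adding a leading row.
  independent-rows : ∀ {K k m n} (Ms : Fin K → Mat m n)
    (f : Fin k → Fin m) (g : Fin k → Fin n) → Injective _≡_ _≡_ f → Injective _≡_ _≡_ g →
    (cs : Fin k → Fin K → Carrier) →
    (∀ t → linCombM (cs t) Ms (f t) (g t) ≉0) →
    (∀ t j → toℕ j ℕ.< toℕ (g t) → linCombM (cs t) Ms (f t) j ≈ 0#) →
    (∀ t i j → toℕ i ℕ.< toℕ (f t) → linCombM (cs t) Ms i j ≈ 0#) →
    ¬ ¬ (∃[ c ] LinIndepV (λ t → linCombM c Ms (f t)))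
  independent-rows {K} {k} {m} {n} Ms f g f-inj g-inj cs lead≉0 left≈0 above≈0 = do
    vs-dual ← LinIndep⇒HasDual (leading⇒LinIndep vs g g-inj lead≉0 left≈0)
    -- The keys are the row indices, so rows are treated from the top down; the combination starts
    -- as zero.
    c , us , us-dual , done ← sweep Done f f-inj vs vs-dual (λ _ → 0#) replace
    return (c , λ ds comb≈0 → HasDual⇒LinIndep us-dual ds
      (λ x → trans (sum-cong-≋ (λ t → *-congˡ {ds t} (done t x))) (comb≈0 x)))
    where
    vs : Fin k → Vec𝔽 n
    vs t = linCombM (cs t) Ms (f t)

    Done : (Fin K → Carrier) → Fin k → Vec𝔽 n → Set _
    Done c t w = ∀ j → w j ≈ linCombM c Ms (f t) j

    replace : ∀ c t φ → dot φ (vs t) ≈ 1# → ¬ ¬ (∃[ c′ ] ∃[ w ] (dot φ w ≉0 × Done c′ t w ×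
      (∀ u y → toℕ (f u) ℕ.< toℕ (f t) → Done c u y → Done c′ u y)))
    replace c t φ φv≈1 = do
      no φrow≉0 ← ¬¬-excluded-middle {A = dot φ row ≈ 0#}
        where
        yes φrow≈0 → return
          ( c′ , linCombM c′ Ms (f t)
          , (λ φw≈0 → 0≉1 (trans (sym φw≈0) (φw≈1 φrow≈0)))
          , (λ _ → refl)
          -- The added matrix is zero above row `f t`, so the rows fixed earlier stay rows of the
          -- new combination.
          , (λ u y fu<ft y≈ j → begin
              y j                                                  ≈⟨ y≈ j ⟩
              linCombM c Ms (f u) j                                ≈⟨ +-identityʳ _ ⟨
              linCombM c Ms (f u) j + 0#                           ≈⟨ +-congˡ (above≈0 t (f u) j fu<ft) ⟨
              linCombM c Ms (f u) j + linCombM (cs t) Ms (f u) j   ≈⟨ dot-+ˡ c (cs t) (λ s → Ms s (f u) j) ⟨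
              linCombM c′ Ms (f u) j                               ∎))
      return (c , row , φrow≉0 , (λ _ → refl) , (λ _ _ _ d → d))
      where
      row : Vec𝔽 n
      row = linCombM c Ms (f t)
      c′ : Fin K → Carrier
      c′ s = c s + cs t s

      φw≈1 : dot φ row ≈ 0# → dot φ (linCombM c′ Ms (f t)) ≈ 1#
      φw≈1 φrow≈0 = begin
        dot φ (linCombM c′ Ms (f t))      ≈⟨ dot-congʳ φ (λ j → dot-+ˡ c (cs t) (λ s → Ms s (f t) j)) ⟩
        dot φ (λ j → row j + vs t j)      ≈⟨ dot-comm φ _ ⟩
        dot (λ j → row j + vs t j) φ      ≈⟨ dot-+ˡ row (vs t) φ ⟩
        dot row φ + dot (vs t) φ          ≈⟨ +-cong (trans (dot-comm row φ) φrow≈0) (trans (dot-comm (vs t) φ) φv≈1) ⟩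
        0# + 1#                           ≈⟨ +-identityˡ 1# ⟩
        1#                                ∎

  -- Gaussian elimination and leading positions

  Leads : ∀ {n} → Vec𝔽 n → Fin n → Set ℓ
  Leads v q = v q ≉0 × (∀ x → toℕ x ℕ.< toℕ q → v x ≈ 0#)

  eliminate : ∀ {k n} (vs : Fin (suc k) → Vec𝔽 n) → Fin (suc k) → (Fin k → Carrier) → Fin k → Vec𝔽 n
  eliminate vs t ρ u x = vs (punchIn t u) x + ρ u * vs t x

  -- The multiples of `vs t` spread over the reduced vectors add up to the single coefficient
  -- `dot cs ρ`. This carries independence to the reduced family and leading positions back.
  linComb-eliminate : ∀ {k n} (vs : Fin (suc k) → Vec𝔽 n) t ρ cs x →
    linCombV (insertAt cs t (dot cs ρ)) vs x ≈ linCombV cs (eliminate vs t ρ) x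
  linComb-eliminate vs t ρ cs x = begin
    linCombV ds vs x
      ≈⟨ sum-remove {i = t} (λ u → ds u * vs u x) ⟩
    ds t * vs t x + sum (λ u → ds (punchIn t u) * vs (punchIn t u) x)
      ≈⟨ +-cong (*-congʳ (reflexive (VFₚ.insertAt-lookup cs t _)))
           (sum-cong-≋ (λ u → *-congʳ (reflexive (VFₚ.insertAt-punchIn cs t _ u)))) ⟩
    dot cs ρ * vs t x + sum (λ u → cs u * vs (punchIn t u) x)
      ≈⟨ +-congʳ (trans (*-distribʳ-sum (vs t x) (λ u → cs u * ρ u)) (sum-cong-≋ (λ u → *-assoc (cs u) (ρ u) (vs t x)))) ⟩
    sum (λ u → cs u * (ρ u * vs t x)) + sum (λ u → cs u * vs (punchIn t u) x)
      ≈⟨ trans (+-comm _ _) (sym (∑-distrib-+ (λ u → cs u * vs (punchIn t u) x) _)) ⟩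
    sum (λ u → cs u * vs (punchIn t u) x + cs u * (ρ u * vs t x))
      ≈⟨ sum-cong-≋ (λ u → distribˡ (cs u) _ _) ⟨
    linCombV cs (eliminate vs t ρ) x ∎
    where
    ds = insertAt cs t (dot cs ρ)

  LinIndep-eliminate : ∀ {k n} (vs : Fin (suc k) → Vec𝔽 n) t ρ → LinIndepV vs → LinIndepV (eliminate vs t ρ)
  LinIndep-eliminate vs t ρ indep cs comb≈0 u = trans
    (reflexive (≡.sym (VFₚ.insertAt-punchIn cs t _ u)))
    (indep (insertAt cs t (dot cs ρ)) (λ x → trans (linComb-eliminate vs t ρ cs x) (comb≈0 x)) (punchIn t u))

  HasPivots : ∀ {k n} → (Fin k → Vec𝔽 n) → (Fin n → Bool) → Set _
  HasPivots vs h = ∀ q → h q ≡ true → ∃[ cs ] Leads (linCombV cs vs) q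

  -- Elimination column by column. A zero column is dropped; otherwise a pivot clears it, which
  -- costs one vector and gains one leading position.
  pivots : ∀ {k n} (vs : Fin k → Vec𝔽 n) → LinIndepV vs → ¬ ¬ (∃[ h ] (k ≤ count h × HasPivots vs h))
  pivots {zero}  {zero}  vs indep = return ((λ ()) , z≤n , (λ ()))
  -- Without coordinates every combination is zero, even that with all coefficients 1.
  pivots {suc k} {zero}  vs indep = contradiction (sym (indep (λ _ → 1#) (λ ()) zero)) 0≉1
  pivots {k} {suc n} vs indep = do
    yes (t , vt≉0) ← ¬¬-excluded-middle {A = ∃[ t ] vs t zero ≉0}
      where
      no none → do
        vs₀≈0 ← Fin-¬¬-pull (λ t vt≉0 → none (t , vt≉0))
        h , k≤ , hasPivots ← pivots-tail vs indep vs₀≈0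
        return (false ∷ h , k≤ , λ { (suc q) hq → hasPivots q hq })
    pivot vs indep t vt≉0
    where
    pivots-tail : ∀ {k} (vs : Fin k → Vec𝔽 (suc n)) → LinIndepV vs → (∀ t → vs t zero ≈ 0#) →
      ¬ ¬ (∃[ h ] (k ≤ count h × (∀ q → h q ≡ true → ∃[ cs ] Leads (linCombV cs vs) (suc q))))
    pivots-tail vs indep vs₀≈0 = do
      let comb₀≈0 = λ cs → sum-zero (λ t → trans (*-congˡ {cs t} (vs₀≈0 t)) (zeroʳ _))
      h , k≤ , hasPivots ← pivots (λ t → vs t ∘ suc)
        (λ cs comb≈0 → indep cs (λ { zero → comb₀≈0 cs ; (suc x) → comb≈0 x }))
      return (h , k≤ , λ q hq → let cs , lead≉0 , left≈0 = hasPivots q hq in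
        cs , lead≉0 , λ { zero _ → comb₀≈0 cs ; (suc x) (s≤s x<q) → left≈0 x x<q })

    pivot : ∀ {k} (vs : Fin k → Vec𝔽 (suc n)) → LinIndepV vs → ∀ t → vs t zero ≉0 →
      ¬ ¬ (∃[ h ] (k ≤ count h × HasPivots vs h))
    pivot {suc k} vs indep t vt≉0 with inverse _ vt≉0
    ... | i , vt*i≈1 = do
      let ρ = λ u → - (vs (punchIn t u) zero * i)
      h , k≤ , hasPivots ← pivots-tail (eliminate vs t ρ) (LinIndep-eliminate vs t ρ indep)
                             (λ u → cancel-pivot (vs (punchIn t u) zero) vt*i≈1)
      return (true ∷ h , s≤s k≤ , λ
        -- The pivot vector itself leads at the first column.
        { zero _ → δ t , (λ vt≈0 → vt≉0 (trans (sym (dot-δˡ t (λ u → vs u zero))) vt≈0)) , (λ _ ())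
        ; (suc q) hq → let cs , lead≉0 , left≈0 = hasPivots q hq in
            insertAt cs t (dot cs ρ)
          , (λ lead≈0 → lead≉0 (trans (sym (linComb-eliminate vs t ρ cs (suc q))) lead≈0))
          , (λ x x<q → trans (linComb-eliminate vs t ρ cs x) (left≈0 x x<q)) })

  -- From subspaces to subgraphs and back

  linComb-support : ∀ {k m n} {G : BGraph m n} {Ms : Fin k → Mat m n} → (∀ t → InS G (Ms t)) →
    ∀ cs → InS G (linCombM cs Ms)
  linComb-support Ms⊆G cs i j Gij = sum-zero (λ t → trans (*-congˡ (Ms⊆G t i j Gij)) (zeroʳ (cs t)))

  edge-of-nonzero : ∀ {m n} {G : BGraph m n} {A : Mat m n} → InS G A → ∀ i j → A i j ≉0 → G i j ≡ true
  edge-of-nonzero {G = G} A⊆G i j Aij≉0 with G i j in Gij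
  ... | true  = ≡.refl
  ... | false = contradiction (A⊆G i j Gij) Aij≉0

  subspace⇒subgraph : ∀ {m n} {G : BGraph m n} {r k} → HasRankBoundedSubspace G r k →
    ¬ ¬ (∃[ k′ ] (k ≤ k′ × HasSparseSubgraph G r k′))
  subspace⇒subgraph {m} {n} {G} {r} {k} (Ms , indep , Ms⊆G , rank≤r) = do
    h , k≤ , hasPivots ← pivots (flatten ∘ Ms) (λ cs comb≈0 → indep cs
      (λ i j → trans (reflexive (≡.sym (flatten-linComb cs i j))) (comb≈0 (combine i j))))
    let
      H : BGraph m n
      H i j = h (combine i j)

      -- `combine` numbers positions row by row, so being zero before a leading position means being
      -- zero in all higher rows and to the left in the same row.
      leading : ∀ {i j} → H i j ≡ true → ∃[ cs ]
        (linCombM cs Ms i j ≉0 × (∀ j′ → toℕ j′ ℕ.< toℕ j → linCombM cs Ms i j′ ≈ 0#) ×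
        (∀ i′ j′ → toℕ i′ ℕ.< toℕ i → linCombM cs Ms i′ j′ ≈ 0#))
      leading {i} {j} = λ Hij → let cs , lead≉0 , before≈0 = hasPivots (combine i j) Hij in
        cs
        , (λ lead≈0 → lead≉0 (trans (reflexive (flatten-linComb cs i j)) lead≈0))
        , (λ j′ j′<j → trans (reflexive (≡.sym (flatten-linComb cs i j′)))
            (before≈0 _ (combine-monoʳ-< i j′<j)))
        , (λ i′ j′ i′<i → trans (reflexive (≡.sym (flatten-linComb cs i′ j′)))
            (before≈0 _ (Finₚ.combine-monoˡ-< j′ j i′<i)))

      H⊆G : H ⊆G G
      H⊆G = λ i j Hij → let cs , lead≉0 , _ = leading Hij in
        edge-of-nonzero (linComb-support Ms⊆G cs) i j lead≉0

      sparse : MatchingNumber≤ H r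
      -- A matching of size `suc r` would give one combination whose rows `f` are independent,
      -- against the rank bound.
      sparse = λ (f , g , f-inj , g-inj , edge) →
        independent-rows Ms f g f-inj g-inj
          (λ t → proj₁ (leading (edge t)))
          (λ t → proj₁ (proj₂ (leading (edge t))))
          (λ t → proj₁ (proj₂ (proj₂ (leading (edge t)))))
          (λ t → proj₂ (proj₂ (proj₂ (leading (edge t)))))
          (λ (c , rows-indep) → rank≤r c (f , rows-indep))
    return (numEdges H , ≡.subst (k ≤_) (sumℕ-combine m _) k≤ , H , H⊆G , sparse , ≡.refl)
    where
    flatten-linComb : ∀ cs i j → linCombV cs (flatten ∘ Ms) (combine i j) ≡ linCombM cs Ms i j
    flatten-linComb cs i j = ≡.cong (λ p → Σ𝔽 (λ t → cs t * uncurry (Ms t) p)) (Finₚ.remQuot-combine i j)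

    combine-monoʳ-< : ∀ {m n} (i : Fin m) {j j′ : Fin n} → toℕ j ℕ.< toℕ j′ →
      toℕ (combine i j) ℕ.< toℕ (combine i j′)
    combine-monoʳ-< {n = n} i {j} {j′} j<j′
      rewrite Finₚ.toℕ-combine i j | Finₚ.toℕ-combine i j′ = ℕₚ.+-monoʳ-< (n ℕ.* toℕ i) j<j′

  -- The subspace consists of all matrices supported on `H`, with the matrix units of its edges as
  -- basis.
  subgraph⇒subspace : ∀ {m n} {G : BGraph m n} {r k} → HasSparseSubgraph G r k → HasRankBoundedSubspace G r k
  subgraph⇒subspace {m} {n} {G} {r} (H , H⊆G , sparse , ≡.refl)
    -- Turns the dimension into the count that indexes `enumerate`.
    rewrite ≡.sym (count-flatten H) = Es , indep , (λ t i j Gij → Es⊆H t i j (H-false Gij)) , rank≤r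
    where
    e = proj₁ (enumerate (flatten H))

    Es : Fin (count (flatten H)) → Mat m n
    Es t i j = δ (e t) (combine i j)

    H-false : ∀ {i j} → G i j ≡ false → H i j ≡ false
    H-false {i} {j} Gij with H i j in Hij
    ... | false = ≡.refl
    ... | true  = contradiction (≡.trans (≡.sym Gij) (H⊆G i j Hij)) (λ ())

    Es⊆H : ∀ t → InS H (Es t)
    Es⊆H t i j Hij = δ-≢ λ et≡ij → contradiction
      (≡.trans (≡.sym (proj₂ (proj₂ (enumerate (flatten H))) t))
        (≡.trans (≡.cong (flatten H) et≡ij) (≡.trans (flatten-combine H i j) Hij))) (λ ())

    indep : LinIndepM Es
    indep cs comb≈0 t with Finₚ.combine-surjective {m} {n} (e t)
    ... | i , j , ij≡et = begin
      cs t                           ≈⟨ *-identityʳ (cs t) ⟨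
      cs t * 1#                      ≈⟨ *-congˡ (δ-refl (e t)) ⟨
      cs t * δ (e t) (e t)           ≡⟨ ≡.cong (λ q → cs t * δ (e t) q) ij≡et ⟨
      cs t * δ (e t) (combine i j)   ≈⟨ sum-single t (λ u u≢t → trans (*-congˡ (δ-≢ (λ eu≡ij →
                                          u≢t (proj₁ (proj₂ (enumerate (flatten H))) (≡.trans eu≡ij ij≡et))))) (zeroʳ _)) ⟨
      linCombM cs Es i j             ≈⟨ comb≈0 i j ⟩
      0#                             ∎

    rank≤r : ∀ cs → Rank≤ (linCombM cs Es) r
    -- `sparse` is a negation, so a matching under double negation refutes it.
    rank≤r cs (f , rows-indep) = matching sparse
      where
      matching : ¬ ¬ HasMatching H (suc r)
      matching = do
        rows-dual ← LinIndep⇒HasDual rows-indep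
        g , g-inj , nonzero ← transversal (λ t → linCombM cs Es (f t)) rows-dual
        return {A = HasMatching H (suc r)} (f , g
          -- `Rank≤` allows repeated rows in a selection; independence makes `f` injective.
          , (λ ft≡fu → HasDual⇒injective rows-dual (≡.cong (linCombM cs Es) ft≡fu))
          , g-inj
          , (λ t → edge-of-nonzero (linComb-support Es⊆H cs) (f t) (g t) (nonzero t)))

-- Equivalence of the two maxima

theorem1p5 : ∀ {c ℓ : Level} (𝔽 : Field c ℓ) (m n : ℕ) → m ≤ n →
    (G : BGraph m n) (r : ℕ) → 1 ≤ r → r ≤ m →
    ∀ k → IsMax (HasSparseSubgraph G r) k ⇔ IsMax (LinAlg.HasRankBoundedSubspace 𝔽 G r) k
theorem1p5 𝔽 m n _ G r _ _ k = mk⇔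
  (λ (subgraph , max) → subgraph⇒subspace 𝔽 subgraph , λ j subspace →
    decidable-stable (j ℕ.≤? k) (do
      k′ , j≤k′ , subgraph′ ← subspace⇒subgraph 𝔽 subspace
      return (ℕₚ.≤-trans j≤k′ (max k′ subgraph′))))
  -- The subgraph found has `k′ ≥ k` edges; its own subspace has dimension `k′`, so maximality
  -- forces `k′ ≡ k`.
  (λ (subspace , max) → decidable-stable (HasSparseSubgraph? G r k) (do
      k′ , k≤k′ , subgraph ← subspace⇒subgraph 𝔽 subspace
      return (≡.subst (HasSparseSubgraph G r)
        (ℕₚ.≤-antisym (max k′ (subgraph⇒subspace 𝔽 subgraph)) k≤k′) subgraph))
    , λ j subgraph → max j (subgraph⇒subspace 𝔽 subgraph))
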